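{- Let $M$ be a matroid with cycle system $\mathcal{C}=\{C_1,\dots,C_g\}$, $g=g(M)$. Then the poset of coparking functions $P^*(\mathcal{C})$ is a pure multicomplex. An element $a\in P^*(\mathcal{C})$ is maximal if and only if $\deg(a)=r(M)-\beta$, where $\beta$ is the number of bridges of $M$.
   Context: Matroids are on finite ground sets; $r(M)$ is the rank and $g(M)=|E(M)|-r(M)$ the corank. $\mathbb{N}$ includes $0$, and $\mathbb{N}^0=\{()\}$. A *cycle* of $M$ is a union of circuits; a *bridge* is a coloop. Unique union: for a family $\mathcal{A}=\{A_1,\dots,A_g\}$ of subsets of a set and $\sigma\subseteq[g]=\{1,\dots,g\}$, $\mathcal{A}_\sigma$ is the set of elements $e\in\bigcup_{i\in\sigma}A_i$ for which there is exactly one $i\in\sigma$ with $e\in A_i$. A *cycle system* for $M$ is a collection $\mathcal{C}=\{C_1,\dots,C_g\}$ of cycles of $M$ with $g=g(M)$ such that for every nonempty $\sigma\subseteq[g]$ the unique union $\mathcal{C}_\sigma$ is dependent in $M$. A *coparking function* with respect to $\mathcal{C}$ is a vector $a=(a_1,\dots,a_g)\in\mathbb{N}^g$ such that for every nonempty $\sigma\subseteq[g]$ there is some $i\in\sigma$ with $a_i<|C_i\cap\mathcal{C}_\sigma|$ (if $g=0$, the only one is $()$). $P^*(\mathcal{C})$ is the set of coparking functions, ordered componentwise; $\deg(a)=\sum_i a_i$, with $\deg(())=0$. A *multicomplex* is (identified with) a finite order ideal of $\mathbb{N}^g$, i.e. a finite subset closed under passing to componentwise smaller vectors; it is *pure*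 if all its maximal elements have the same degree. -}

module Defs where

open import Data.Fin using (Fin)
open import Data.Fin.Properties using (_≟_; any?; all?)
open import Data.Fin.Subset
open import Data.Fin.Subset.Properties using (_∈?_; _⊂?_; anySubset?)
open import Data.List using (List; []; _∷_; map; _++_; filter)
open import Data.List.Extrema.Nat using (max)
import Data.List.Membership.Propositional as List
open import Data.List.Relation.Unary.All using (All)
open import Data.Nat using (ℕ; zero; suc; _∸_; _≤_; _<_)
open import Data.Product using (∃; ∃!; _×_; _,_)
open import Data.Vec using (Vec; []; _∷_; lookup; sum; tabulate)
open import Data.Vec.Relation.Binary.Pointwise.Inductive using (Pointwise)
open import Function using (_∘_; _⇔_)
open import Level using (0ℓ)
open import Relation.Binary.PropositionalEquality using (_≡_)
open import Relation.Nullary using (¬_; Dec; does; ¬?; _×-dec_; _→-dec_)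
open import Relation.Nullary.Decidable using (map′; decidable-stable)
open import Relation.Unary using (Pred; Decidable)

private
  variable
    n g : ℕ

-- The subset { e ∣ P e }.
comprehension : {P : Pred (Fin n) 0ℓ} → Decidable P → Subset n
comprehension P? = tabulate (does ∘ P?)

subsets : ∀ n → List (Subset n)
subsets zero    = [] ∷ []
subsets (suc n) = map (inside ∷_) (subsets n) ++ map (outside ∷_) (subsets n)

-- Matroids on the ground set Fin n, by their independent sets.  Independence
-- is required to be decidable, which classically is no restriction; it makes
-- the rank and the set of bridges computable.
record Matroid (n : ℕ) : Set₁ where
  field
    Indep      : Pred (Subset n) 0ℓ
    indep?     : Decidable Indep
    ⊥-indep    : Indep ⊥
    hereditary : ∀ {I J} → I ⊆ J → Indep J → Indep I
    augment    : ∀ {I J} → Indep I → Indep J → ∣ I ∣ < ∣ J ∣ →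
                 ∃ λ e → e ∈ J × e ∉ I × Indep (I ∪ ⁅ e ⁆)

  Dependent : Pred (Subset n) 0ℓ
  Dependent S = ¬ Indep S

  IsCircuit : Pred (Subset n) 0ℓ
  IsCircuit C = Dependent C × (∀ D → D ⊂ C → Indep D)

  IsCycle : Pred (Subset n) 0ℓ
  IsCycle C = ∃ λ Cs → All IsCircuit Cs × C ≡ ⋃ Cs

  IsBasis : Pred (Subset n) 0ℓ
  IsBasis B = Indep B × ¬ (∃ λ I → Indep I × B ⊂ I)

  isBasis? : Decidable IsBasis
  isBasis? B = indep? B ×-dec ¬? (anySubset? λ I → indep? I ×-dec B ⊂? I)

  -- The largest size of an independent set.
  rank : ℕ
  rank = max 0 (map ∣_∣ (filter indep? (subsets n)))

  corank : ℕ
  corank = n ∸ rank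

  -- A bridge (coloop) is an element of every basis.  In particular there are
  -- at most rank many bridges, so rank ∸ ∣ bridges ∣ is never truncated.
  IsBridge : Pred (Fin n) 0ℓ
  IsBridge e = ∀ B → IsBasis B → e ∈ B

  isBridge? : Decidable IsBridge
  isBridge? e = map′
    (λ ¬∃ B basis → decidable-stable (e ∈? B) λ e∉B → ¬∃ (B , basis , e∉B))
    (λ { all (B , basis , e∉B) → e∉B (all B basis) })
    (¬? (anySubset? λ B → isBasis? B ×-dec ¬? (e ∈? B)))

  bridges : Subset n
  bridges = comprehension isBridge?

UniquelyCovered : Vec (Subset n) g → Subset g → Pred (Fin n) 0ℓ
UniquelyCovered 𝒜 σ e = ∃! _≡_ λ i → i ∈ σ × e ∈ lookup 𝒜 i

uniquelyCovered? : (𝒜 : Vec (Subset n) g) (σ : Subset g) →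
                   Decidable (UniquelyCovered 𝒜 σ)
uniquelyCovered? 𝒜 σ e = any? λ i → covers? i ×-dec
  map′ (λ h {j} → h j) (λ h j → h {j}) (all? λ j → covers? j →-dec i ≟ j)
  where
  covers? : ∀ i → Dec (i ∈ σ × e ∈ lookup 𝒜 i)
  covers? i = i ∈? σ ×-dec e ∈? lookup 𝒜 i

-- The unique union 𝒜_σ.
uniqueUnion : Vec (Subset n) g → Subset g → Subset n
uniqueUnion 𝒜 σ = comprehension (uniquelyCovered? 𝒜 σ)

-- The members of a cycle system are indexed by Fin g.  They are automatically
-- distinct: if C_i = C_j with i ≠ j, then the unique union over {i , j} is
-- empty, hence independent.
record IsCycleSystem (M : Matroid n) (𝒞 : Vec (Subset n) g) : Set where
  open Matroid M
  field
    size      : g ≡ corank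
    cycles    : ∀ i → IsCycle (lookup 𝒞 i)
    dependent : ∀ σ → Nonempty σ → Dependent (uniqueUnion 𝒞 σ)

IsCoparking : Vec (Subset n) g → Pred (Vec ℕ g) 0ℓ
IsCoparking 𝒞 a = ∀ σ → Nonempty σ →
  ∃ λ i → i ∈ σ × lookup a i < ∣ lookup 𝒞 i ∩ uniqueUnion 𝒞 σ ∣

infix 4 _≤ᵛ_

_≤ᵛ_ : Vec ℕ g → Vec ℕ g → Set
_≤ᵛ_ = Pointwise _≤_

deg : Vec ℕ g → ℕ
deg = sum

IsMaximal : Pred (Vec ℕ g) 0ℓ → Pred (Vec ℕ g) 0ℓ
IsMaximal P a = P a × (∀ b → P b → a ≤ᵛ b → a ≡ b)

record IsMulticomplex (P : Pred (Vec ℕ g) 0ℓ) : Set where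
  field
    finite     : ∃ λ as → ∀ a → P a ⇔ a List.∈ as
    downClosed : ∀ a b → a ≤ᵛ b → P b → P a

record IsPureMulticomplex (P : Pred (Vec ℕ g) 0ℓ) : Set where
  field
    isMulticomplex : IsMulticomplex P
    pure           : ∀ a b → IsMaximal P a → IsMaximal P b → deg a ≡ deg b

{-# OPTIONS --safe #-}

-- Start with σ = [g] and use the coparking condition of a to remove from σ,
-- one by one, indices i ∈ σ with a_i < |C_i ∩ 𝒞_σ|.  The sets C_i ∩ 𝒞_σ met on
-- the way partition U = C_1 ∪ … ∪ C_g, and replacing each a_i by |C_i ∩ 𝒞_σ| − 1
-- gives a coparking function above a, of degree |U| − g.  It remains to see
-- that U is the complement of the bridges.  Cycles contain no bridge.
-- Conversely let B be a basis.  No 𝒞_σ lies inside B, so the indices can be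
-- removed one by one, each time losing an element of 𝒞_σ outside B.  Hence
-- |U ∖ B| ≥ g = |E ∖ B|, and every element outside U lies in B.
module Submission where

open import Defs
open import Data.Fin using (Fin; zero; suc)
open import Data.Fin.Properties using (any?; _≟_)
open import Data.Fin.Subset
  using (Subset; inside; outside; ⊥; ⊤; ⁅_⁆; ∁; _∩_; _∪_; _─_; _-_; ⋃; ∣_∣;
         _∈_; _∉_; _⊆_; _⊂_; _⊃_; Nonempty)
open import Data.Fin.Subset.Induction using (Acc; acc; ⊂-wellFounded; ⊃-wellFounded)
open import Data.Fin.Subset.Properties
open import Data.List using (List; []; _∷_; map; filter; upTo; cartesianProductWith)
import Data.List.Membership.Propositional as List
open import Data.List.Membership.Propositional.Properties
  using (∈-++⁺ˡ; ∈-++⁺ʳ; ∈-map⁺; ∈-map⁻; ∈-filter⁺; ∈-filter⁻;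
         ∈-cartesianProductWith⁺; ∈-upTo⁺)
open import Data.List.Extrema.Nat using (argmax-sel; xs≤max)
import Data.List.Relation.Unary.All as All
open import Data.List.Relation.Unary.Any as Any using (here)
open import Data.Nat using (ℕ; zero; suc; pred; _+_; _∸_; _≤_; _<_; _<?_; s≤s; z≤n; >-nonZero)
open import Data.Nat.Properties hiding (_≟_)
open import Data.Product using (∃; _×_; _,_; proj₁; proj₂)
open import Data.Sum using (inj₁; inj₂)
open import Data.Vec using (Vec; []; _∷_; lookup; replicate; _[_]≔_; here; there)
open import Data.Vec.Properties
  using (lookup∘tabulate; []=⇒lookup; lookup⇒[]=; lookup∘update; lookup∘update′;
         lookup-replicate)
import Data.Vec.Relation.Binary.Pointwise.Extensional as Extensional
open import Data.Vec.Relation.Binary.Pointwise.Inductive as Pointwise using ([]; _∷_)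
open import Function using (_⇔_; mk⇔; id; _∘_)
open import Level using (0ℓ)
open import Relation.Binary.PropositionalEquality
open import Relation.Nullary using (¬_; Dec; does; yes; no; ¬?; _×-dec_; _→-dec_; contradiction)
open import Relation.Nullary.Decidable using (decidable-stable; dec-true; map′)
open import Relation.Unary using (Pred; Decidable)

private
  variable
    n g : ℕ

-- Finite subsets

∈-comprehension⁺ : {P : Pred (Fin n) 0ℓ} (P? : Decidable P) {x : Fin n} →
                   P x → x ∈ comprehension P?
∈-comprehension⁺ P? {x} px =
  lookup⇒[]= x _ (trans (lookup∘tabulate (does ∘ P?) x) (dec-true (P? x) px))

∈-comprehension⁻ : {P : Pred (Fin n) 0ℓ} (P? : Decidable P) {x : Fin n} →
                   x ∈ comprehension P? → P x
∈-comprehension⁻ P? {x} x∈ with P? x | trans (sym (lookup∘tabulate (does ∘ P?) x)) ([]=⇒lookup x∈)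
... | yes px | _ = px
... | no _   | ()

∈-subsets : (p : Subset n) → p List.∈ subsets n
∈-subsets []            = here refl
∈-subsets (inside ∷ p)  = ∈-++⁺ˡ (∈-map⁺ (inside ∷_) (∈-subsets p))
∈-subsets (outside ∷ p) = ∈-++⁺ʳ (map (inside ∷_) (subsets _)) (∈-map⁺ (outside ∷_) (∈-subsets p))

x∈p─q⇒x∉q : (p q : Subset n) {x : Fin n} → x ∈ p ─ q → x ∉ q
x∈p─q⇒x∉q (_ ∷ _) (inside ∷ _) () here
x∈p─q⇒x∉q (_ ∷ p) (_ ∷ q) (there x∈) (there x∈q) = x∈p─q⇒x∉q p q x∈ x∈q

x∉p-x : (p : Subset n) {x : Fin n} → x ∉ p - x
x∉p-x p {x} x∈ = x∈p─q⇒x∉q p ⁅ x ⁆ x∈ (x∈⁅x⁆ x)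

p-x⊆p : (p : Subset n) (x : Fin n) → p - x ⊆ p
p-x⊆p p x = p─q⊆p p ⁅ x ⁆

x∈⋃⁻ : (ps : List (Subset n)) {x : Fin n} → x ∈ ⋃ ps → ∃ λ p → p List.∈ ps × x ∈ p
x∈⋃⁻ [] x∈ = contradiction x∈ ∉⊥
x∈⋃⁻ (p ∷ ps) x∈ with x∈p∪q⁻ p (⋃ ps) x∈
... | inj₁ x∈p = p , here refl , x∈p
... | inj₂ x∈⋃ with q , q∈ps , x∈q ← x∈⋃⁻ ps x∈⋃ = q , Any.there q∈ps , x∈q

∣p∪q∣≡∣p∣+∣q∣ : (p q : Subset n) → (∀ {x} → x ∈ p → x ∉ q) → ∣ p ∪ q ∣ ≡ ∣ p ∣ + ∣ q ∣
∣p∪q∣≡∣p∣+∣q∣ [] [] _ = refl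
∣p∪q∣≡∣p∣+∣q∣ (inside ∷ p) (inside ∷ q) disjoint = contradiction here (disjoint here)
∣p∪q∣≡∣p∣+∣q∣ (inside ∷ p) (outside ∷ q) disjoint =
  cong suc (∣p∪q∣≡∣p∣+∣q∣ p q λ x∈p x∈q → disjoint (there x∈p) (there x∈q))
∣p∪q∣≡∣p∣+∣q∣ (outside ∷ p) (inside ∷ q) disjoint =
  trans (cong suc (∣p∪q∣≡∣p∣+∣q∣ p q λ x∈p x∈q → disjoint (there x∈p) (there x∈q)))
        (sym (+-suc ∣ p ∣ ∣ q ∣))
∣p∪q∣≡∣p∣+∣q∣ (outside ∷ p) (outside ∷ q) disjoint =
  ∣p∪q∣≡∣p∣+∣q∣ p q λ x∈p x∈q → disjoint (there x∈p) (there x∈q)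

x∈p⇒∣p∣≡1+∣p-x∣ : (p : Subset n) {x : Fin n} → x ∈ p → ∣ p ∣ ≡ suc ∣ p - x ∣
x∈p⇒∣p∣≡1+∣p-x∣ p {x} x∈p = begin
  ∣ p ∣                   ≡⟨ cong ∣_∣ p≡ ⟩
  ∣ ⁅ x ⁆ ∪ (p - x) ∣     ≡⟨ ∣p∪q∣≡∣p∣+∣q∣ ⁅ x ⁆ (p - x) (λ y∈x y∈ → x∈p─q⇒x∉q p ⁅ x ⁆ y∈ y∈x) ⟩
  ∣ ⁅ x ⁆ ∣ + ∣ p - x ∣   ≡⟨ cong (_+ ∣ p - x ∣) (∣⁅x⁆∣≡1 x) ⟩
  suc ∣ p - x ∣           ∎
  where
  open ≡-Reasoning
  to : p ⊆ ⁅ x ⁆ ∪ (p - x)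
  to {y} y∈p with y ≟ x
  ... | yes refl = x∈p∪q⁺ (inj₁ (x∈⁅x⁆ x))
  ... | no y≢x   = x∈p∪q⁺ (inj₂ (x∈p∧x≢y⇒x∈p-y y∈p y≢x))
  from : ⁅ x ⁆ ∪ (p - x) ⊆ p
  from y∈ with x∈p∪q⁻ ⁅ x ⁆ (p - x) y∈
  ... | inj₁ y∈x rewrite x∈⁅y⁆⇒x≡y x y∈x = x∈p
  ... | inj₂ y∈p-x = p-x⊆p p x y∈p-x
  p≡ : p ≡ ⁅ x ⁆ ∪ (p - x)
  p≡ = ⊆-antisym to from

p⊆q∧∣q∣≤∣p∣⇒q⊆p : {p q : Subset n} → p ⊆ q → ∣ q ∣ ≤ ∣ p ∣ → q ⊆ p
p⊆q∧∣q∣≤∣p∣⇒q⊆p {p = p} p⊆q ∣q∣≤∣p∣ {x} x∈q = decidable-stable (x ∈? p) λ x∉p →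
  <⇒≱ (p⊂q⇒∣p∣<∣q∣ (p⊆q , x , x∈q , x∉p)) ∣q∣≤∣p∣

allSubset? : {P : Pred (Subset n) 0ℓ} → Decidable P → Dec (∀ p → P p)
allSubset? P? = map′
  (λ ¬∃ p → decidable-stable (P? p) λ ¬Pp → ¬∃ (p , ¬Pp))
  (λ all (p , ¬Pp) → ¬Pp (all p))
  (¬? (anySubset? (¬? ∘ P?)))

-- Vectors of natural numbers

≤ᵛ-lookup⁺ : {a b : Vec ℕ g} → (∀ i → lookup a i ≤ lookup b i) → a ≤ᵛ b
≤ᵛ-lookup⁺ a≤b = Extensional.extensional⇒inductive (Extensional.ext a≤b)

deg-mono : {a b : Vec ℕ g} → a ≤ᵛ b → deg a ≤ deg b
deg-mono []          = z≤n
deg-mono (x≤y ∷ a≤b) = +-mono-≤ x≤y (deg-mono a≤b)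

-- A strict increase in one entry cannot be offset by the others, since none of them decreases.
≤ᵛ∧deg≡⇒≡ : {a b : Vec ℕ g} → a ≤ᵛ b → deg a ≡ deg b → a ≡ b
≤ᵛ∧deg≡⇒≡ [] _ = refl
≤ᵛ∧deg≡⇒≡ {a = x ∷ a} {y ∷ b} (x≤y ∷ a≤b) eq
  with refl ← ≤-antisym x≤y (+-cancelʳ-≤ (deg a) y x
         (≤-trans (+-monoʳ-≤ y (deg-mono a≤b)) (≤-reflexive (sym eq))))
  = cong (x ∷_) (≤ᵛ∧deg≡⇒≡ a≤b (+-cancelˡ-≡ x (deg a) (deg b) eq))

deg-replicate-0 : ∀ g → deg (replicate g 0) ≡ 0
deg-replicate-0 zero    = refl
deg-replicate-0 (suc g) = deg-replicate-0 g

deg-update : (b : Vec ℕ g) (i : Fin g) (x : ℕ) → lookup b i ≡ 0 → deg (b [ i ]≔ x) ≡ x + deg b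
deg-update (_ ∷ b) zero    x refl = refl
deg-update (y ∷ b) (suc i) x eq   = begin
  y + deg (b [ i ]≔ x) ≡⟨ cong (y +_) (deg-update b i x eq) ⟩
  y + (x + deg b)      ≡⟨ +-assoc y x (deg b) ⟨
  y + x + deg b        ≡⟨ cong (_+ deg b) (+-comm y x) ⟩
  x + y + deg b        ≡⟨ +-assoc x y (deg b) ⟩
  x + (y + deg b)      ∎
  where open ≡-Reasoning

box : ∀ g → ℕ → List (Vec ℕ g)
box zero    k = [] ∷ []
box (suc g) k = cartesianProductWith _∷_ (upTo k) (box g k)

∈-box : ∀ {k} (a : Vec ℕ g) → (∀ i → lookup a i < k) → a List.∈ box g k
∈-box []      _   = here refl
∈-box (x ∷ a) a<k = ∈-cartesianProductWith⁺ _∷_ (∈-upTo⁺ (a<k zero)) (∈-box a (a<k ∘ suc))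

bounded∧decidable⇒finite : {P : Pred (Vec ℕ g) 0ℓ} (k : ℕ) → Decidable P →
  (∀ a → P a → ∀ i → lookup a i < k) → ∃ λ as → ∀ a → P a ⇔ a List.∈ as
bounded∧decidable⇒finite {g = g} k P? bounded = filter P? (box g k) , λ a → mk⇔
  (λ Pa → ∈-filter⁺ P? (∈-box a (bounded a Pa)) Pa)
  (λ a∈ → proj₂ (∈-filter⁻ P? {xs = box g k} a∈))

-- Matroids

module _ (M : Matroid n) where
  open Matroid M

  private
    indepSizes : List ℕ
    indepSizes = map ∣_∣ (filter indep? (subsets n))

  ∣indep∣≤rank : ∀ {I} → Indep I → ∣ I ∣ ≤ rank
  ∣indep∣≤rank {I} ind = All.lookup (xs≤max 0 indepSizes)
    (∈-map⁺ ∣_∣ (∈-filter⁺ indep? (∈-subsets I) ind))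

  rank-attained : ∃ λ I → Indep I × ∣ I ∣ ≡ rank
  rank-attained with argmax-sel id 0 indepSizes
  -- Here the maximum is the default value 0, which the empty set attains.
  ... | inj₁ rank≡0 = ⊥ , ⊥-indep , trans (∣⊥∣≡0 n) (sym rank≡0)
  ... | inj₂ rank∈  with I , I∈ , rank≡ ← ∈-map⁻ ∣_∣ rank∈ =
    I , proj₂ (∈-filter⁻ indep? {xs = subsets n} I∈) , sym rank≡

  rank≤n : rank ≤ n
  rank≤n with I , _ , ∣I∣≡ ← rank-attained = subst (_≤ n) ∣I∣≡ (∣p∣≤n I)

  -- A basis with fewer than `rank` elements could be augmented from a largest independent set,
  -- against its maximality.
  ∣basis∣≡rank : ∀ {B} → IsBasis B → ∣ B ∣ ≡ rank
  ∣basis∣≡rank {B} (indB , maximal) = ≤-antisym (∣indep∣≤rank indB) (≮⇒≥ λ ∣B∣<rank →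
    let J , indJ , ∣J∣≡ = rank-attained
        e , _ , e∉B , ind = augment indB indJ (subst (∣ B ∣ <_) (sym ∣J∣≡) ∣B∣<rank)
    in maximal (B ∪ ⁅ e ⁆ , ind , p⊆p∪q ⁅ e ⁆ , e , x∈p∪q⁺ (inj₂ (x∈⁅x⁆ e)) , e∉B))

  ∃-basis : ∀ {I} → Indep I → ∃ λ B → IsBasis B × I ⊆ B
  ∃-basis = extend (⊃-wellFounded _)
    where
    extend : ∀ {I} → Acc _⊃_ I → Indep I → ∃ λ B → IsBasis B × I ⊆ B
    extend {I} (acc larger) ind with anySubset? (λ J → indep? J ×-dec I ⊂? J)
    ... | no maximal = I , (ind , maximal) , ⊆-refl
    ... | yes (J , indJ , I⊂J) with B , basis , J⊆B ← extend (larger I⊂J) indJ =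
      B , basis , ⊆-trans (p⊂q⇒p⊆q I⊂J) J⊆B

  -- By minimality `C - e` is independent and extends to a basis. If `e` were a bridge, this basis
  -- would contain all of the dependent set `C`.
  circuit⇒¬bridge : ∀ {C e} → IsCircuit C → e ∈ C → ¬ IsBridge e
  circuit⇒¬bridge {C} {e} (dep , minimal) e∈C bridge
    with B , basis , C-e⊆B ← ∃-basis (minimal (C - e) (x∈p⇒p-x⊂p e∈C))
    = dep (hereditary C⊆B (proj₁ basis))
    where
    C⊆B : C ⊆ B
    C⊆B {x} x∈C with x ≟ e
    ... | yes refl = bridge B basis
    ... | no x≢e   = C-e⊆B (x∈p∧x≢y⇒x∈p-y x∈C x≢e)

  cycle⇒¬bridge : ∀ {C e} → IsCycle C → e ∈ C → ¬ IsBridge e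
  cycle⇒¬bridge (Cs , circuits , refl) e∈C with D , D∈Cs , e∈D ← x∈⋃⁻ Cs e∈C =
    circuit⇒¬bridge (All.lookup circuits D∈Cs) e∈D

-- Unions and unique unions

module _ (𝒜 : Vec (Subset n) g) where

  Covered : Subset g → Pred (Fin n) 0ℓ
  Covered σ e = ∃ λ i → i ∈ σ × e ∈ lookup 𝒜 i

  covered? : ∀ σ → Decidable (Covered σ)
  covered? σ e = any? λ i → i ∈? σ ×-dec e ∈? lookup 𝒜 i

  union : Subset g → Subset n
  union σ = comprehension (covered? σ)

  ∈-union⁺ : ∀ {σ i e} → i ∈ σ → e ∈ lookup 𝒜 i → e ∈ union σ
  ∈-union⁺ {σ} i∈σ e∈A = ∈-comprehension⁺ (covered? σ) (_ , i∈σ , e∈A)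

  ∈-union⁻ : ∀ {σ e} → e ∈ union σ → Covered σ e
  ∈-union⁻ {σ} = ∈-comprehension⁻ (covered? σ)

  union-mono : ∀ {σ τ} → σ ⊆ τ → union σ ⊆ union τ
  union-mono σ⊆τ e∈ with i , i∈σ , e∈A ← ∈-union⁻ e∈ = ∈-union⁺ (σ⊆τ i∈σ) e∈A

  -- For `i ∈ σ` this is the part of the union covered by `i` alone. For other `i` it may contain
  -- elements that belong to an index of `σ`, so the lemmas below assume membership.
  owned : Subset g → Fin g → Subset n
  owned σ i = lookup 𝒜 i ∩ uniqueUnion 𝒜 σ

  ∈-owned⁺ : ∀ {σ i e} → i ∈ σ → e ∈ lookup 𝒜 i → e ∉ union (σ - i) → e ∈ owned σ i
  ∈-owned⁺ {σ} {i} {e} i∈σ e∈A e∉ = x∈p∩q⁺ (e∈A ,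
    ∈-comprehension⁺ (uniquelyCovered? 𝒜 σ) (i , (i∈σ , e∈A) , unique))
    where
    unique : ∀ {j} → j ∈ σ × e ∈ lookup 𝒜 j → i ≡ j
    unique {j} (j∈σ , e∈Aⱼ) = decidable-stable (i ≟ j) λ i≢j →
      e∉ (∈-union⁺ (x∈p∧x≢y⇒x∈p-y j∈σ (i≢j ∘ sym)) e∈Aⱼ)

  -- Uniqueness in the form that suits the removal of indices: `e` leaves the union together with
  -- `i`.
  ∈-uniqueUnion⁻ : ∀ {σ e} → e ∈ uniqueUnion 𝒜 σ →
                   ∃ λ i → i ∈ σ × e ∈ lookup 𝒜 i × e ∉ union (σ - i)
  ∈-uniqueUnion⁻ {σ} {e} e∈ with i , (i∈σ , e∈A) , unique ← ∈-comprehension⁻ (uniquelyCovered? 𝒜 σ) e∈ =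
    i , i∈σ , e∈A , disjoint
    where
    disjoint : e ∉ union (σ - i)
    disjoint e∈′ with j , j∈ , e∈Aⱼ ← ∈-union⁻ e∈′
      with refl ← unique (p-x⊆p σ i j∈ , e∈Aⱼ) = x∉p-x σ j∈

  ∈-owned⁻ : ∀ {σ i e} → i ∈ σ → e ∈ owned σ i → e ∈ lookup 𝒜 i × e ∉ union (σ - i)
  ∈-owned⁻ {σ} {i} i∈σ e∈ with e∈A , e∈! ← x∈p∩q⁻ (lookup 𝒜 i) (uniqueUnion 𝒜 σ) e∈
    -- The only index `j` covering `e` must be `i`: otherwise `i` remains in `σ - j` and still
    -- covers `e`.
    with j , j∈σ , e∈Aⱼ , e∉ ← ∈-uniqueUnion⁻ e∈! with i ≟ j
  ... | yes refl = e∈A , e∉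
  ... | no i≢j   = contradiction (∈-union⁺ (x∈p∧x≢y⇒x∈p-y i∈σ i≢j) e∈A) e∉

  -- With fewer competing indices, `i` can only gain elements that it alone covers. Hence a bound
  -- that holds at `σ` persists for every smaller test set containing `i`.
  owned-antitone : ∀ {σ τ i} → τ ⊆ σ → i ∈ τ → owned σ i ⊆ owned τ i
  owned-antitone {σ} {τ} {i} τ⊆σ i∈τ e∈ with e∈A , e∉ ← ∈-owned⁻ (τ⊆σ i∈τ) e∈ =
    ∈-owned⁺ i∈τ e∈A (e∉ ∘ union-mono τ-i⊆σ-i)
    where
    τ-i⊆σ-i : τ - i ⊆ σ - i
    τ-i⊆σ-i j∈ = x∈p∧x≢y⇒x∈p-y (τ⊆σ (p-x⊆p τ i j∈)) λ { refl → x∉p-x τ j∈ }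

  -- An element of `union σ` missing from `union (σ - i)` can be covered by `i` only. Iterated, this
  -- gives the partition behind the degree count.
  ∣union∣-remove : ∀ {σ i} → i ∈ σ → ∣ union σ ∣ ≡ ∣ owned σ i ∣ + ∣ union (σ - i) ∣
  ∣union∣-remove {σ} {i} i∈σ = trans (cong ∣_∣ (⊆-antisym to from))
    (∣p∪q∣≡∣p∣+∣q∣ (owned σ i) (union (σ - i)) (proj₂ ∘ ∈-owned⁻ i∈σ))
    where
    to : union σ ⊆ owned σ i ∪ union (σ - i)
    to {e} e∈ with e ∈? union (σ - i)
    ... | yes e∈′ = x∈p∪q⁺ (inj₂ e∈′)
    ... | no e∉ with j , j∈σ , e∈A ← ∈-union⁻ e∈ with j ≟ i
    ...   | yes refl = x∈p∪q⁺ (inj₁ (∈-owned⁺ i∈σ e∈A e∉))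
    ...   | no j≢i   = contradiction (∈-union⁺ (x∈p∧x≢y⇒x∈p-y j∈σ j≢i) e∈A) e∉
    from : owned σ i ∪ union (σ - i) ⊆ union σ
    from e∈ with x∈p∪q⁻ (owned σ i) (union (σ - i)) e∈
    ... | inj₁ e∈₁ = ∈-union⁺ i∈σ (proj₁ (∈-owned⁻ i∈σ e∈₁))
    ... | inj₂ e∈₂ = union-mono (p-x⊆p σ i) e∈₂

  -- Choose an element of `X` covered by exactly one index of `σ` and remove that index: the union
  -- then loses this element of `X`. So each removal costs at least one element. It is applied with
  -- `X` the complement of a basis.
  ∣σ∣≤∣union∩X∣ : (X : Subset n) → (∀ τ → Nonempty τ → Nonempty (uniqueUnion 𝒜 τ ∩ X)) →
                  ∀ σ → ∣ σ ∣ ≤ ∣ union σ ∩ X ∣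
  ∣σ∣≤∣union∩X∣ X meets σ = go (⊂-wellFounded σ)
    where
    go : ∀ {σ} → Acc _⊂_ σ → ∣ σ ∣ ≤ ∣ union σ ∩ X ∣
    go {σ} (acc smaller) with nonempty? σ
    ... | no empty rewrite Empty-unique empty | ∣⊥∣≡0 g = z≤n
    ... | yes ne
      with e , e∈ ← meets σ ne
      with e∈! , e∈X ← x∈p∩q⁻ (uniqueUnion 𝒜 σ) X e∈
      with i , i∈σ , e∈A , e∉ ← ∈-uniqueUnion⁻ e∈! = begin
        ∣ σ ∣                        ≡⟨ x∈p⇒∣p∣≡1+∣p-x∣ σ i∈σ ⟩
        suc ∣ σ - i ∣                ≤⟨ s≤s (go (smaller (x∈p⇒p-x⊂p i∈σ))) ⟩
        suc ∣ union (σ - i) ∩ X ∣    ≤⟨ p⊂q⇒∣p∣<∣q∣ shrinks ⟩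
        ∣ union σ ∩ X ∣              ∎
      where
      open ≤-Reasoning
      shrinks : union (σ - i) ∩ X ⊂ union σ ∩ X
      shrinks =
        (λ x∈ → let x∈U , x∈X = x∈p∩q⁻ (union (σ - i)) X x∈ in
          x∈p∩q⁺ (union-mono (p-x⊆p σ i) x∈U , x∈X)) ,
        e , x∈p∩q⁺ (∈-union⁺ i∈σ e∈A , e∈X) , e∉ ∘ proj₁ ∘ x∈p∩q⁻ (union (σ - i)) X

-- Coparking functions

  isCoparking? : Decidable (IsCoparking 𝒜)
  isCoparking? a = allSubset? λ σ → nonempty? σ →-dec
    any? λ i → i ∈? σ ×-dec lookup a i <? ∣ owned σ i ∣

  coparking-downClosed : ∀ a b → a ≤ᵛ b → IsCoparking 𝒜 b → IsCoparking 𝒜 a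
  coparking-downClosed a b a≤b cop σ ne with i , i∈σ , b<  ← cop σ ne =
    i , i∈σ , ≤-<-trans (Pointwise.lookup a≤b i) b<

  -- Testing on a singleton leaves no choice of index, so each entry is bounded separately.
  coparking-bounded : ∀ a → IsCoparking 𝒜 a → ∀ i → lookup a i < n
  coparking-bounded a cop i with j , j∈ , a< ← cop ⁅ i ⁆ (i , x∈⁅x⁆ i)
    with refl ← x∈⁅y⁆⇒x≡y i j∈ = <-≤-trans a< (∣p∣≤n (owned ⁅ i ⁆ i))

  coparking-isMulticomplex : IsMulticomplex (IsCoparking 𝒜)
  coparking-isMulticomplex = record
    { finite     = bounded∧decidable⇒finite n isCoparking? coparking-bounded
    ; downClosed = coparking-downClosed
    }

  -- The invariant of the induction on `σ`: `b` passes all tests inside `σ` and is extended by zero,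
  -- so that `deg b` sums over `σ` only. The degree equation is written additively to avoid
  -- truncated subtraction.
  record Saturation (a : Vec ℕ g) (σ : Subset g) : Set where
    field
      b         : Vec ℕ g
      above     : ∀ {i} → i ∈ σ → lookup a i ≤ lookup b i
      outside-0 : ∀ {i} → i ∉ σ → lookup b i ≡ 0
      coparking : ∀ τ → τ ⊆ σ → Nonempty τ → ∃ λ i → i ∈ τ × lookup b i < ∣ owned τ i ∣
      degree    : deg b + ∣ σ ∣ ≡ ∣ union σ ∣

  saturate-⊥ : ∀ a → Saturation a ⊥
  saturate-⊥ a = record
    { b         = replicate g 0
    ; above     = λ i∈⊥ → contradiction i∈⊥ ∉⊥
    ; outside-0 = λ {i} _ → lookup-replicate i 0
    ; coparking = λ τ τ⊆⊥ (i , i∈τ) → contradiction (τ⊆⊥ i∈τ) ∉⊥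
    ; degree    = trans (cong₂ _+_ (deg-replicate-0 g) (∣⊥∣≡0 g)) (sym ∣union∣≡0)
    }
    where
    ∣union∣≡0 : ∣ union ⊥ ∣ ≡ 0
    ∣union∣≡0 = trans (cong ∣_∣ (Empty-unique λ (e , e∈) → ∉⊥ (proj₁ (proj₂ (∈-union⁻ e∈))))) (∣⊥∣≡0 n)

  -- The new index `i` receives the largest value that the test at `σ` permits. A test set
  -- containing `i` is then passed by `i` itself, because `owned` grows as the test set shrinks; one
  -- without `i` lies in `σ - i`, where the old vector passes it.
  saturate-insert : ∀ a {σ i} → i ∈ σ → lookup a i < ∣ owned σ i ∣ →
                    Saturation a (σ - i) → Saturation a σ
  saturate-insert a {σ} {i} i∈σ a< s = record
    { b         = b [ i ]≔ c
    ; above     = above′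
    ; outside-0 = λ {j} j∉σ →
        trans (lookup∘update′ (λ { refl → j∉σ i∈σ }) b c) (outside-0 (j∉σ ∘ p-x⊆p σ i))
    ; coparking = coparking′
    ; degree    = degree′
    }
    where
    open Saturation s
    c = pred ∣ owned σ i ∣
    1+c≡ : suc c ≡ ∣ owned σ i ∣
    -- The strict bound on `lookup a i` makes `owned σ i` nonempty, so the predecessor is a genuine
    -- one.
    1+c≡ = suc-pred ∣ owned σ i ∣ {{>-nonZero (≤-<-trans z≤n a<)}}
    above′ : ∀ {j} → j ∈ σ → lookup a j ≤ lookup (b [ i ]≔ c) j
    above′ {j} j∈σ with j ≟ i
    ... | yes refl rewrite lookup∘update i b c = ≤-pred (subst (lookup a i <_) (sym 1+c≡) a<)
    ... | no j≢i rewrite lookup∘update′ j≢i b c = above (x∈p∧x≢y⇒x∈p-y j∈σ j≢i)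
    coparking′ : ∀ τ → τ ⊆ σ → Nonempty τ →
                 ∃ λ j → j ∈ τ × lookup (b [ i ]≔ c) j < ∣ owned τ j ∣
    coparking′ τ τ⊆σ ne with i ∈? τ
    ... | yes i∈τ = i , i∈τ , (begin
      suc (lookup (b [ i ]≔ c) i)   ≡⟨ cong suc (lookup∘update i b c) ⟩
      suc c                         ≡⟨ 1+c≡ ⟩
      ∣ owned σ i ∣                 ≤⟨ p⊆q⇒∣p∣≤∣q∣ (owned-antitone τ⊆σ i∈τ) ⟩
      ∣ owned τ i ∣                 ∎)
      where open ≤-Reasoning
    ... | no i∉τ
      with j , j∈τ , b< ← coparking τ (λ k∈τ → x∈p∧x≢y⇒x∈p-y (τ⊆σ k∈τ) λ { refl → i∉τ k∈τ }) ne =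
      j , j∈τ , subst (_< ∣ owned τ j ∣) (sym (lookup∘update′ (λ { refl → i∉τ j∈τ }) b c)) b<
    degree′ : deg (b [ i ]≔ c) + ∣ σ ∣ ≡ ∣ union σ ∣
    degree′ = begin
      -- The entry overwritten at `i` was 0, as `i` lies outside `σ - i`.
      deg (b [ i ]≔ c) + ∣ σ ∣            ≡⟨ cong₂ _+_ (deg-update b i c (outside-0 (x∉p-x σ))) (x∈p⇒∣p∣≡1+∣p-x∣ σ i∈σ) ⟩
      c + deg b + suc ∣ σ - i ∣           ≡⟨ +-suc (c + deg b) ∣ σ - i ∣ ⟩
      suc c + deg b + ∣ σ - i ∣           ≡⟨ +-assoc (suc c) (deg b) ∣ σ - i ∣ ⟩
      suc c + (deg b + ∣ σ - i ∣)         ≡⟨ cong₂ _+_ 1+c≡ degree ⟩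
      ∣ owned σ i ∣ + ∣ union (σ - i) ∣   ≡⟨ ∣union∣-remove i∈σ ⟨
      ∣ union σ ∣                         ∎
      where open ≡-Reasoning

  saturate : ∀ a → IsCoparking 𝒜 a → ∀ σ → Saturation a σ
  saturate a cop σ = go (⊂-wellFounded σ)
    where
    go : ∀ {σ} → Acc _⊂_ σ → Saturation a σ
    go {σ} (acc smaller) with nonempty? σ
    ... | no empty rewrite Empty-unique empty = saturate-⊥ a
    -- The test of `a` at `σ` selects the index to remove; the rest is saturated first and `i` is
    -- put back afterwards.
    ... | yes ne with i , i∈σ , a< ← cop σ ne =
      saturate-insert a i∈σ a< (go (smaller (x∈p⇒p-x⊂p i∈σ)))

  -- Saturating at `⊤` covers all test sets. The degree reached does not depend on `a`, which is the
  -- source of purity.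
  coparking-dominated : ∀ a → IsCoparking 𝒜 a →
    ∃ λ b → IsCoparking 𝒜 b × a ≤ᵛ b × deg b ≡ ∣ union ⊤ ∣ ∸ g
  coparking-dominated a cop =
    b , (λ τ → coparking τ ⊆⊤) , ≤ᵛ-lookup⁺ (λ i → above ∈⊤) , (begin
      deg b                      ≡⟨ m+n∸n≡m (deg b) g ⟨
      deg b + g ∸ g              ≡⟨ cong (λ k → deg b + k ∸ g) (∣⊤∣≡n g) ⟨
      deg b + ∣ ⊤ {g} ∣ ∸ g      ≡⟨ cong (_∸ g) degree ⟩
      ∣ union ⊤ ∣ ∸ g            ∎)
    where
    open Saturation (saturate a cop ⊤)
    open ≡-Reasoning

-- Maximal elements when everything lies below an element of degree `d`

module _ {P : Pred (Vec ℕ g) 0ℓ} {d : ℕ}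
         (dominated : ∀ a → P a → ∃ λ b → P b × a ≤ᵛ b × deg b ≡ d) where

  deg≤ : ∀ {a} → P a → deg a ≤ d
  deg≤ Pa with b , _ , a≤b , refl ← dominated _ Pa = deg-mono a≤b

  maximal⇒deg≡ : ∀ {a} → IsMaximal P a → deg a ≡ d
  maximal⇒deg≡ (Pa , max) with b , Pb , a≤b , refl ← dominated _ Pa = cong deg (max b Pb a≤b)

  -- Anything above `a` has degree at most `d`, hence the same degree as `a`, and so equals `a`.
  deg≡⇒maximal : ∀ {a} → P a → deg a ≡ d → IsMaximal P a
  deg≡⇒maximal Pa refl = Pa , λ b Pb a≤b → ≤ᵛ∧deg≡⇒≡ a≤b (≤-antisym (deg-mono a≤b) (deg≤ Pb))

-- The union of a cycle system and the bridges

module _ (M : Matroid n) (𝒞 : Vec (Subset n) g) (cs : IsCycleSystem M 𝒞) where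
  open Matroid M
  open IsCycleSystem cs

  ∁union⊆basis : ∀ {B e} → IsBasis B → e ∉ union 𝒞 ⊤ → e ∈ B
  ∁union⊆basis {B} {e} basis e∉U = decidable-stable (e ∈? B) λ e∉B →
    e∉U (proj₁ (x∈p∩q⁻ (union 𝒞 ⊤) (∁ B) (∁B⊆ (x∉p⇒x∈∁p e∉B))))
    where
    -- A unique union contained in `B` would be independent by heredity.
    meets : ∀ τ → Nonempty τ → Nonempty (uniqueUnion 𝒞 τ ∩ ∁ B)
    meets τ ne = decidable-stable (nonempty? _) λ empty → dependent τ ne
      (hereditary (λ {x} x∈ → decidable-stable (x ∈? B) λ x∉B →
        empty (x , x∈p∩q⁺ (x∈ , x∉p⇒x∈∁p x∉B))) (proj₁ basis))
    ∣∁B∣≤ : ∣ ∁ B ∣ ≤ ∣ union 𝒞 ⊤ ∩ ∁ B ∣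
    ∣∁B∣≤ = begin
      ∣ ∁ B ∣               ≡⟨ ∣∁p∣≡n∸∣p∣ B ⟩
      n ∸ ∣ B ∣             ≡⟨ cong (n ∸_) (∣basis∣≡rank M basis) ⟩
      corank                ≡⟨ size ⟨
      g                     ≡⟨ ∣⊤∣≡n g ⟨
      ∣ ⊤ {g} ∣             ≤⟨ ∣σ∣≤∣union∩X∣ 𝒞 (∁ B) meets ⊤ ⟩
      ∣ union 𝒞 ⊤ ∩ ∁ B ∣   ∎
      where open ≤-Reasoning
    ∁B⊆ : ∁ B ⊆ union 𝒞 ⊤ ∩ ∁ B
    -- The part of the union outside `B` is a subset of `∁ B` with at least as many elements, hence
    -- all of it.
    ∁B⊆ = p⊆q∧∣q∣≤∣p∣⇒q⊆p (p∩q⊆q (union 𝒞 ⊤) (∁ B)) ∣∁B∣≤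

  -- Cycles contain no bridge, and an element outside the union lies in every basis.
  union≡∁bridges : union 𝒞 ⊤ ≡ ∁ bridges
  union≡∁bridges = ⊆-antisym
    (λ e∈U → let i , _ , e∈C = ∈-union⁻ 𝒞 e∈U in
      x∉p⇒x∈∁p (cycle⇒¬bridge M (cycles i) e∈C ∘ ∈-comprehension⁻ isBridge?))
    (λ {e} e∈ → decidable-stable (e ∈? union 𝒞 ⊤) λ e∉U →
      x∈∁p⇒x∉p e∈ (∈-comprehension⁺ isBridge? λ B basis → ∁union⊆basis basis e∉U))

  ∣union∣∸g : ∣ union 𝒞 ⊤ ∣ ∸ g ≡ rank ∸ ∣ bridges ∣
  ∣union∣∸g = begin
    ∣ union 𝒞 ⊤ ∣ ∸ g             ≡⟨ cong₂ _∸_ (trans (cong ∣_∣ union≡∁bridges) (∣∁p∣≡n∸∣p∣ bridges)) size ⟩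
    -- The two subtractions are exchanged so that `n ∸ (n ∸ rank)` appears, which is `rank` because
    -- `rank` is at most `n`.
    n ∸ ∣ bridges ∣ ∸ (n ∸ rank)   ≡⟨ ∸-+-assoc n ∣ bridges ∣ (n ∸ rank) ⟩
    n ∸ (∣ bridges ∣ + (n ∸ rank)) ≡⟨ cong (n ∸_) (+-comm ∣ bridges ∣ (n ∸ rank)) ⟩
    n ∸ ((n ∸ rank) + ∣ bridges ∣) ≡⟨ ∸-+-assoc n (n ∸ rank) ∣ bridges ∣ ⟨
    n ∸ (n ∸ rank) ∸ ∣ bridges ∣   ≡⟨ cong (_∸ ∣ bridges ∣) (m∸[m∸n]≡n (rank≤n M)) ⟩
    rank ∸ ∣ bridges ∣             ∎
    where open ≡-Reasoning

  dominated-by-degree : ∀ a → IsCoparking 𝒞 a →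
    ∃ λ b → IsCoparking 𝒞 b × a ≤ᵛ b × deg b ≡ rank ∸ ∣ bridges ∣
  dominated-by-degree a cop with b , copb , a≤b , eq ← coparking-dominated 𝒞 a cop =
    b , copb , a≤b , trans eq ∣union∣∸g

proposition4p3 : ∀ {n g : ℕ} (M : Matroid n) (𝒞 : Vec (Subset n) g) → IsCycleSystem M 𝒞 →
    IsPureMulticomplex (IsCoparking 𝒞) ×
    (∀ (a : Vec ℕ g) → IsCoparking 𝒞 a →
    (IsMaximal (IsCoparking 𝒞) a ⇔ deg a ≡ Matroid.rank M ∸ ∣ Matroid.bridges M ∣))
proposition4p3 M 𝒞 cs =
  record
    { isMulticomplex = coparking-isMulticomplex 𝒞
    ; pure           = λ a b maxa maxb →
        trans (maximal⇒deg≡ dominated maxa) (sym (maximal⇒deg≡ dominated maxb))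
    } ,
  λ a cop → mk⇔ (maximal⇒deg≡ dominated) (deg≡⇒maximal dominated cop)
  where
  dominated = dominated-by-degree M 𝒞 cs
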